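{- Let $G$ be a graph and let $\mathcal{H}$ be the set of all induced subgraphs of $G$. Then $$\varphi(G) \geq \max_{H\in\mathcal{H}} \dfrac{1}{2}\left(\chi(H)-\omega(H)\right).$$
   Context: All graphs are finite, simple and undirected, with at least one vertex. $\chi$ denotes the chromatic number and $\omega$ the clique number. For a proper vertex coloring $c$ of $G$ and an induced subgraph $H$ of $G$, let $c(H)$ be the set of colors used by $c$ on the vertices of $H$. Define $\varphi_c(G)=\max_{H}\,(|c(H)|-\chi(H))$, the maximum over all induced subgraphs $H$ of $G$. The chromatic discrepancy is $\varphi(G)=\min_c \varphi_c(G)$, the minimum over all proper colorings $c$ of $G$ (with any number of colors). -}

module Defs where

open import Data.Fin.Base using (Fin; zero; suc; toℕ; finToFun; funToFin)
open import Data.Fin.Properties as Fin using (all?; any?)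
open import Data.Fin.Subset using (Subset; inside; outside; _∈_; ∣_∣; ⊤; ⊥)
open import Data.Fin.Subset.Properties using (_∈?_; ∣⊤∣≡n; ∉⊥)
open import Data.Integer.Base as ℤ using (ℤ; +_)
import Data.Integer.Properties as ℤ
import Data.Rational.Properties as ℚ
open import Data.List.Base as List using (List; []; _∷_; _++_; length; tabulate; deduplicate; allFin; upTo)
import Data.List.Extrema as Extrema
import Data.List.Membership.Propositional as L
import Data.List.Membership.Propositional.Properties as L
open import Data.List.Properties using (length-map)
open import Data.List.Relation.Unary.All as All using ([]; _∷_)
open import Data.List.Relation.Unary.Any as Any using (Any; here; there)
import Data.List.Relation.Unary.Any.Properties as Any using (map⁺; lookup-index)
import Data.List.Relation.Unary.Unique.DecPropositional.Properties as Unique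
open import Data.List.Relation.Unary.Unique.Propositional using (Unique; []; _∷_)
open import Data.Nat.Base as ℕ using (ℕ; zero; suc; NonZero; _≤_; _^_; s≤s)
import Data.Nat.Properties as ℕ
open import Data.Product.Base using (Σ; ∃; ∃-syntax; _×_; _,_; proj₁; proj₂)
open import Data.Sum.Base using (inj₂)
open import Data.Vec.Base using ([]; _∷_)
open import Function.Base using (_∘_; id; it)
open import Level using (0ℓ)
open import Relation.Binary.Bundles using (TotalOrder; DecTotalOrder)
open import Relation.Binary.Core using (Rel)
open import Relation.Binary.Definitions using (Decidable; Symmetric; Irreflexive; DecidableEquality)
open import Relation.Binary.PropositionalEquality
  using (_≡_; _≢_; _≗_; refl; sym; trans; cong; subst)
open import Relation.Nullary.Decidable using (Dec; yes; no; _→-dec_; ¬?; recompute)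
open import Relation.Nullary.Negation using (contradiction)
open import Relation.Unary using (Pred) renaming (Decidable to Decidable₁)

open TotalOrder using (Carrier)

-- The numbers χ, ω, φ_c and φ are first components of the proofs that the
-- corresponding extrema exist; second components carry their characterisations.
-- The proofs are abstract, so only the characterisations are visible.

IsMinimum : {A B : Set} → Rel B 0ℓ → (A → B) → B → Set
IsMinimum _≼_ f b = (∃[ a ] f a ≡ b) × (∀ a → b ≼ f a)

IsMaximum : {A B : Set} → Rel B 0ℓ → (A → B) → B → Set
IsMaximum _≼_ f b = (∃[ a ] f a ≡ b) × (∀ a → f a ≼ b)

-- Adjacency is decidable, as for every finite graph classically; without this
-- χ, ω and φ need not exist constructively.
record Graph (n : ℕ) : Set₁ where
  infix 4 _~_ _~?_
  field
    _~_    : Rel (Fin n) 0ℓ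
    _~?_   : Decidable _~_
    ~-sym  : Symmetric _~_
    ~-irr  : Irreflexive _≡_ _~_

-- The increasing enumeration of the elements of S.
embed : ∀ {n} (S : Subset n) → Fin ∣ S ∣ → Fin n
embed (outside ∷ S) i       = suc (embed S i)
embed (inside  ∷ S) zero    = zero
embed (inside  ∷ S) (suc i) = suc (embed S i)

-- An induced subgraph of a graph on Fin n is determined by its vertex set,
-- which is nonempty because every graph has at least one vertex.
record InducedSubgraph (n : ℕ) : Set where
  constructor ⟨_⟩
  field
    vertices     : Subset n
    .{{nonZero}} : NonZero ∣ vertices ∣

open InducedSubgraph public using (vertices)

order : ∀ {n} → InducedSubgraph n → ℕ
order H = ∣ vertices H ∣

infix 30 _[_]

_[_] : ∀ {n} → Graph n → (H : InducedSubgraph n) → Graph (order H)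
G [ H ] = record
  { _~_   = λ i j → embed (vertices H) i ~ embed (vertices H) j
  ; _~?_  = λ i j → embed (vertices H) i ~? embed (vertices H) j
  ; ~-sym = ~-sym
  ; ~-irr = λ i≡j → ~-irr (cong (embed (vertices H)) i≡j)
  } where open Graph G

Proper : ∀ {n} {C : Set} → Graph n → (Fin n → C) → Set
Proper G c = ∀ u v → u ~ v → c u ≢ c v
  where open Graph G

Colourable : ∀ {n} → Graph n → ℕ → Set
Colourable {n} G k = ∃[ c ] Proper {C = Fin k} G c

IsClique : ∀ {n} → Graph n → Subset n → Set
IsClique G S = ∀ u v → u ∈ S → v ∈ S → u ≢ v → u ~ v
  where open Graph G

-- Colours are natural numbers, so that a colouring may use any number of them.
ProperColouring : ∀ {n} → Graph n → Set
ProperColouring {n} G = Σ (Fin n → ℕ) (Proper G)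

#colours : ∀ {n} → (Fin n → ℕ) → ℕ
#colours c = length (deduplicate ℕ._≟_ (tabulate c))

-- |c(H)|, for a colouring c of the whole graph
#coloursOn : ∀ {n} → (Fin n → ℕ) → InducedSubgraph n → ℕ
#coloursOn c H = #colours (c ∘ embed (vertices H))

private

  module _ (O : TotalOrder 0ℓ 0ℓ 0ℓ) {A : Set} (f : A → Carrier O) (a₀ : A) (xs : List A) where
    open TotalOrder O using () renaming (_≤_ to _≼_)

    minimum : (∀ a → Any (λ x → f x ≼ f a) xs) → ∃ (IsMinimum _≼_ f)
    minimum dom = _ , (Extrema.argmin O f a₀ xs , refl) ,
                  λ a → Extrema.f[argmin]≤v⁺ O a₀ xs (inj₂ (dom a))

    maximum : (∀ a → Any (λ x → f a ≼ f x) xs) → ∃ (IsMaximum _≼_ f)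
    maximum dom = _ , (Extrema.argmax O f a₀ xs , refl) ,
                  λ a → Extrema.v≤f[argmax]⁺ O a₀ xs (inj₂ (dom a))

  satisfying : {A : Set} {P : Pred A 0ℓ} → Decidable₁ P → List A → List (∃ P)
  satisfying P? [] = []
  satisfying P? (x ∷ xs) with P? x
  ... | yes p = (x , p) ∷ satisfying P? xs
  ... | no  _ = satisfying P? xs

  satisfying⁺ : {A : Set} {P : Pred A 0ℓ} (P? : Decidable₁ P) {Q : Pred A 0ℓ} →
                (∀ {x} → Q x → P x) → ∀ {xs} → Any Q xs → Any (Q ∘ proj₁) (satisfying P? xs)
  satisfying⁺ P? imp {x ∷ xs} q with P? x | q
  ... | yes p | here q′  = here q′
  ... | yes p | there q′ = there (satisfying⁺ P? imp q′)
  ... | no ¬p | here q′  = contradiction (imp q′) ¬p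
  ... | no ¬p | there q′ = satisfying⁺ P? imp q′

  subsets : ∀ n → List (Subset n)
  subsets zero    = [] ∷ []
  subsets (suc n) = List.map (outside ∷_) (subsets n) ++ List.map (inside ∷_) (subsets n)

  ∈-subsets : ∀ {n} (S : Subset n) → S L.∈ subsets n
  ∈-subsets [] = here refl
  ∈-subsets (outside ∷ S) = L.∈-++⁺ˡ (L.∈-map⁺ (outside ∷_) (∈-subsets S))
  ∈-subsets (inside ∷ S) =
    L.∈-++⁺ʳ (List.map (outside ∷_) (subsets _)) (L.∈-map⁺ (inside ∷_) (∈-subsets S))

  functions : ∀ n k → List (Fin n → Fin k)
  functions n k = List.map finToFun (allFin (k ^ n))

  ∈-functions : ∀ {n k} (f : Fin n → Fin k) → Any (_≗ f) (functions n k)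
  ∈-functions f = Any.map (λ { refl → Fin.finToFun-funToFin f })
                          (L.∈-map⁺ finToFun (L.∈-allFin (funToFin f)))

  fromΣ : ∀ {n} → ∃ (λ (S : Subset n) → NonZero ∣ S ∣) → InducedSubgraph n
  fromΣ (S , nz) = ⟨ S ⟩ {{nz}}

  inducedSubgraphs : ∀ n → List (InducedSubgraph n)
  inducedSubgraphs n = List.map fromΣ
    (satisfying (λ S → ℕ.nonZero? ∣ S ∣) (subsets n))

  ∈-inducedSubgraphs : ∀ {n} (H : InducedSubgraph n) → H L.∈ inducedSubgraphs n
  ∈-inducedSubgraphs {n} ⟨ S ⟩ = Any.map⁺ (Any.map (λ { refl → refl })
    (satisfying⁺ (λ S → ℕ.nonZero? ∣ S ∣) {Q = λ S′ → S ≡ S′}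
      (λ { refl → recompute (ℕ.nonZero? ∣ S ∣) it }) (∈-subsets S)))

  proper? : ∀ {n} {C : Set} → DecidableEquality C → (G : Graph n) (c : Fin n → C) → Dec (Proper G c)
  proper? _≟_ G c = all? λ u → all? λ v → (u ~? v) →-dec ¬? (c u ≟ c v)
    where open Graph G

  isClique? : ∀ {n} (G : Graph n) → Decidable₁ (IsClique G)
  isClique? G S = all? λ u → all? λ v →
    (u ∈? S) →-dec ((v ∈? S) →-dec (¬? (u Fin.≟ v) →-dec (u ~? v)))
    where open Graph G

  unique-⊆⇒length≤ : ∀ {xs ys : List ℕ} → Unique xs → (∀ {x} → x L.∈ xs → x L.∈ ys) → length xs ≤ length ys
  unique-⊆⇒length≤ {xs} {ys} unique sub = Fin.injective⇒≤ {f = λ i → Any.index (pos i)} λ {i} {j} eq →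
    lookup-injective unique i j
      (trans (Any.lookup-index (pos i))
        (trans (cong (List.lookup ys) eq) (sym (Any.lookup-index (pos j)))))
    where
    pos : ∀ i → List.lookup xs i L.∈ ys
    pos i = sub (L.∈-lookup i)

    lookup-injective : ∀ {xs : List ℕ} → Unique xs → ∀ i j → List.lookup xs i ≡ List.lookup xs j → i ≡ j
    lookup-injective (x∉ ∷ u) zero    zero    eq = refl
    lookup-injective (x∉ ∷ u) zero    (suc j) eq = contradiction eq (All.lookup x∉ (L.∈-lookup j))
    lookup-injective (x∉ ∷ u) (suc i) zero    eq = contradiction (sym eq) (All.lookup x∉ (L.∈-lookup i))
    lookup-injective (x∉ ∷ u) (suc i) (suc j) eq = cong suc (lookup-injective u i j eq)

  #colours-factor : ∀ {n} {c d : Fin n → ℕ} (r : ℕ → ℕ) → d ≗ r ∘ c → #colours d ≤ #colours c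
  #colours-factor {c = c} {d} r d≗rc = subst (#colours d ≤_) (length-map r (dedup c))
    (unique-⊆⇒length≤ (Unique.deduplicate-! ℕ._≟_ (tabulate d)) sub)
    where
    dedup : (Fin _ → ℕ) → List ℕ
    dedup e = deduplicate ℕ._≟_ (tabulate e)

    sub : ∀ {x} → x L.∈ dedup d → x L.∈ List.map r (dedup c)
    sub x∈ with i , refl ← L.∈-tabulate⁻ (L.∈-deduplicate⁻ ℕ._≟_ (tabulate d) x∈) =
      subst (L._∈ List.map r (dedup c)) (sym (d≗rc i))
        (L.∈-map⁺ r (L.∈-deduplicate⁺ ℕ._≟_ (L.∈-tabulate⁺ i)))

  vertex₀ : ∀ {n} .{{_ : NonZero n}} → Fin n
  vertex₀ {suc n} = zero

  -- Sends each colour used by c to a vertex of that colour.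
  rename : ∀ {n} .{{_ : NonZero n}} → (Fin n → ℕ) → ℕ → Fin n
  rename c x with any? (λ v → c v ℕ.≟ x)
  ... | yes (v , _) = v
  ... | no  _       = vertex₀

  c-rename : ∀ {n} .{{_ : NonZero n}} (c : Fin n → ℕ) v → c (rename c (c v)) ≡ c v
  c-rename c v with any? (λ w → c w ℕ.≟ c v)
  ... | yes (_ , eq) = eq
  ... | no  none     = contradiction (v , refl) none

  toProperColouring : ∀ {n} (G : Graph n) → Σ (Fin n → Fin n) (Proper G) → ProperColouring G
  toProperColouring G (c , p) = toℕ ∘ c , λ u v uv eq → p u v uv (Fin.toℕ-injective eq)

  discrete : ∀ {n} (G : Graph n) → Proper G id
  discrete G u v uv u≡v = Graph.~-irr G u≡v uv

  proper-resp : ∀ {n} {C : Set} (G : Graph n) {c d : Fin n → C} → d ≗ c → Proper G c → Proper G d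
  proper-resp G eq p u v uv du≡dv = p u v uv (trans (sym (eq u)) (trans du≡dv (eq v)))

  colourings : ∀ {n} (G : Graph n) → List (ProperColouring G)
  colourings {n} G = List.map (toProperColouring G) (satisfying (proper? Fin._≟_ G) (functions n n))

  Recolours : ∀ {n} (G : Graph n) → ProperColouring G → Pred (ProperColouring G) 0ℓ
  Recolours G (c , _) (d , _) = ∃[ r ] d ≗ r ∘ c

  recoloured : ∀ {n} .{{_ : NonZero n}} (G : Graph n) (c : ProperColouring G) →
               Any (Recolours G c) (colourings G)
  recoloured {n} G (c , p) = Any.map⁺
    (Any.map (λ {d} → recolours d) (satisfying⁺ (proper? Fin._≟_ G) {Q = _≗ rename c ∘ c}
      (λ eq → proper-resp G eq renamed) (∈-functions (rename c ∘ c))))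
    where
    renamed : Proper G (rename c ∘ c)
    renamed u v uv eq = p u v uv
      (trans (sym (c-rename c u)) (trans (cong c eq) (c-rename c v)))

    recolours : (d : Σ (Fin n → Fin n) (Proper G)) → proj₁ d ≗ rename c ∘ c →
                Recolours G (c , p) (toProperColouring G d)
    recolours d eq = toℕ ∘ rename c , λ v → cong toℕ (eq v)

  colourable? : ∀ {n} (G : Graph n) → Decidable₁ (Colourable G)
  colourable? {n} G k with Any.any? (proper? Fin._≟_ G) (functions n k)
  ... | yes some = yes (Any.satisfied some)
  ... | no none  = no λ (c , p) → none
    (Any.map (λ eq → proper-resp G eq p) (∈-functions c))

abstract

  χ-exists : ∀ {n} (G : Graph n) → ∃ (IsMinimum _≤_ (proj₁ {B = Colourable G}))
  χ-exists {n} G = minimum ℕ.≤-totalOrder proj₁ (n , id , discrete G)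
    (satisfying (colourable? G) (upTo (suc n))) dom
    where
    dom : ∀ ((k , _) : ∃ (Colourable G)) →
          Any (λ x → proj₁ x ≤ k) (satisfying (colourable? G) (upTo (suc n)))
    dom (k , col) with k ℕ.≤? n
    ... | yes k≤n = Any.map (λ { refl → ℕ.≤-refl })
      (satisfying⁺ (colourable? G) {Q = k ≡_} (λ { refl → col }) (L.∈-upTo⁺ (s≤s k≤n)))
    ... | no  k≰n = Any.map (λ { refl → ℕ.<⇒≤ (ℕ.≰⇒> k≰n) })
      (satisfying⁺ (colourable? G) {Q = n ≡_} (λ { refl → id , discrete G })
        (L.∈-upTo⁺ (s≤s ℕ.≤-refl)))

  ω-exists : ∀ {n} (G : Graph n) → ∃ (IsMaximum {∃ (IsClique G)} _≤_ (∣_∣ ∘ proj₁))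
  ω-exists {n} G = maximum ℕ.≤-totalOrder (∣_∣ ∘ proj₁)
    (⊥ , λ u v u∈⊥ → contradiction u∈⊥ ∉⊥)
    (satisfying (isClique? G) (subsets n))
    λ (S , clique) → Any.map (λ { refl → ℕ.≤-refl })
      (satisfying⁺ (isClique? G) {Q = S ≡_} (λ { refl → clique }) (∈-subsets S))

χ : ∀ {n} → Graph n → ℕ
χ G = proj₁ (χ-exists G)

ω : ∀ {n} → Graph n → ℕ
ω G = proj₁ (ω-exists G)

module _ (O : TotalOrder 0ℓ 0ℓ 0ℓ) {n} .{{_ : NonZero n}} (f : InducedSubgraph n → Carrier O) where

  abstract
    maxInduced-exists : ∃ (IsMaximum (TotalOrder._≤_ O) f)
    maxInduced-exists = maximum O f (⟨ ⊤ ⟩ {{subst NonZero (sym (∣⊤∣≡n n)) it}})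
      (inducedSubgraphs n)
      λ H → Any.map (λ { refl → TotalOrder.refl O }) (∈-inducedSubgraphs H)

  maxInduced : Carrier O
  maxInduced = proj₁ maxInduced-exists

ℚ-totalOrder : TotalOrder 0ℓ 0ℓ 0ℓ
ℚ-totalOrder = DecTotalOrder.totalOrder ℚ.≤-decTotalOrder

excess : ∀ {n} (G : Graph n) → ProperColouring G → InducedSubgraph n → ℤ
excess G (c , _) H = + #coloursOn c H ℤ.- + χ (G [ H ])

-- φ_c(G)
discrepancyOf : ∀ {n} .{{_ : NonZero n}} (G : Graph n) → ProperColouring G → ℤ
discrepancyOf G c = maxInduced ℤ.≤-totalOrder (excess G c)

private
  discrepancyOf-mono : ∀ {n} .{{_ : NonZero n}} (G : Graph n) (c d : ProperColouring G) (r : ℕ → ℕ) →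
                       proj₁ d ≗ r ∘ proj₁ c → discrepancyOf G d ℤ.≤ discrepancyOf G c
  discrepancyOf-mono G c d r eq
    with (H , at) , _ ← proj₂ (maxInduced-exists ℤ.≤-totalOrder (excess G d)) =
    ℤ.≤-trans (ℤ.≤-reflexive (sym at)) (ℤ.≤-trans
      (ℤ.+-monoˡ-≤ (ℤ.- + χ (G [ H ])) (ℤ.+≤+ (#colours-factor r (eq ∘ embed (vertices H)))))
      (proj₂ (proj₂ (maxInduced-exists ℤ.≤-totalOrder (excess G c))) H))

  discrepancy-dominated : ∀ {n} .{{_ : NonZero n}} (G : Graph n) (c : ProperColouring G) →
                          Any (λ d → discrepancyOf G d ℤ.≤ discrepancyOf G c) (colourings G)
  discrepancy-dominated G c = Any.map {P = Recolours G c}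
    (λ {d} (r , eq) → discrepancyOf-mono G c d r eq) (recoloured G c)

abstract
  φ-exists : ∀ {n} .{{_ : NonZero n}} (G : Graph n) → ∃ (IsMinimum ℤ._≤_ (discrepancyOf G))
  φ-exists G = minimum ℤ.≤-totalOrder (discrepancyOf G)
    (toProperColouring G (id , discrete G)) (colourings G) (discrepancy-dominated G)

φ : ∀ {n} .{{_ : NonZero n}} → Graph n → ℤ
φ G = proj₁ (φ-exists G)

{-# OPTIONS --safe #-}

-- Every graph on t vertices satisfies 2χ ≤ t + ω: pair off non-adjacent vertices
-- greedily; what remains is a clique, and giving each pair and each remaining
-- vertex its own colour is a proper colouring.  Now let c be a proper colouring
-- of G, let H be an induced subgraph, and let T consist of one vertex of H for
-- each colour in c(H).  Then |T| = |c(T)| = |c(H)| ≥ χ(H) and ω(T) ≤ ω(H), so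
-- 2(|c(T)| − χ(T)) ≥ |c(T)| − ω(T) ≥ χ(H) − ω(H).

module Submission where

open import Defs
open import Data.Bool.Properties using (T-≡)
open import Data.Fin.Base as Fin using (Fin; zero; suc; fromℕ<)
import Data.Fin.Properties as Fin
open import Data.Fin.Subset using (Subset; inside; outside; _∈_; ∣_∣)
open import Data.Integer.Base as ℤ using (ℤ; +_; _-_)
import Data.Integer.Properties as ℤ
import Data.Integer.Tactic.RingSolver as ℤ-Solver
open import Data.List.Base as List using (List; []; _∷_; _++_; length; allFin; deduplicate; tabulate)
open import Data.List.Properties using (length-++; length-map; length-removeAt′; length-tabulate)
import Data.List.Membership.Propositional as L
import Data.List.Membership.Propositional.Properties as L
open import Data.List.Relation.Unary.All as All using (All; []; _∷_)
import Data.List.Relation.Unary.All.Properties as All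
open import Data.List.Relation.Unary.AllPairs using (AllPairs; []; _∷_)
open import Data.List.Relation.Unary.Any as Any using (Any; here; there; any?; _─_)
import Data.List.Relation.Unary.Any.Properties as Any
open import Data.Nat.Base as ℕ using (ℕ; NonZero; suc; _+_; _≤_)
import Data.Nat.Properties as ℕ
import Data.Nat.Tactic.RingSolver as ℕ-Solver
open import Data.Product.Base using (∃-syntax; _×_; _,_; proj₁; proj₂)
open import Data.Rational.Base as ℚ using (_/_; _≥_; _*_; ½; toℚᵘ)
import Data.Rational.Properties as ℚ
import Data.Rational.Unnormalised.Base as ℚᵘ
import Data.Rational.Unnormalised.Properties as ℚᵘ
open import Data.Sum.Base as Sum using (_⊎_; inj₁; inj₂)
open import Data.Vec.Base as Vec using ([]; _∷_; here; there)
import Data.Vec.Properties as Vec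
open import Function.Base using (_∘_)
open import Function.Bundles using (Equivalence)
open import Function.Definitions using (Injective)
open import Level using (0ℓ)
open import Relation.Binary.Core using (Rel)
open import Relation.Binary.Definitions using (Symmetric)
open import Relation.Binary.PropositionalEquality
  using (_≡_; _≢_; refl; sym; trans; cong; subst; subst₂)
open import Relation.Nullary.Decidable using (yes; no; ¬?; ⌊_⌋; fromWitness; toWitness; recompute; decidable-stable)
open import Relation.Nullary.Negation using (¬_; contradiction)

private
  variable
    m n k l : ℕ

-- Enumerated vertex sets and images of maps between them.

embed-∈ : (S : Subset n) (i : Fin ∣ S ∣) → embed S i ∈ S
embed-∈ (outside ∷ S) i       = there (embed-∈ S i)
embed-∈ (inside  ∷ S) zero    = here
embed-∈ (inside  ∷ S) (suc i) = there (embed-∈ S i)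

embed-injective : (S : Subset n) → Injective _≡_ _≡_ (embed S)
embed-injective (outside ∷ S) eq = embed-injective S (Fin.suc-injective eq)
embed-injective (inside  ∷ S) {zero}  {zero}  eq = refl
embed-injective (inside  ∷ S) {suc i} {suc j} eq =
  cong suc (embed-injective S (Fin.suc-injective eq))

embed-surjective : (S : Subset n) {v : Fin n} → v ∈ S → ∃[ i ] embed S i ≡ v
embed-surjective (inside ∷ S) here = zero , refl
embed-surjective (outside ∷ S) (there v∈S) with i , refl ← embed-surjective S v∈S = i , refl
embed-surjective (inside ∷ S) (there v∈S) with i , refl ← embed-surjective S v∈S = suc i , refl

image : (Fin m → Fin n) → Subset n
image f = Vec.tabulate λ v → ⌊ Fin.any? (λ i → f i Fin.≟ v) ⌋

∈-image⁺ : (f : Fin m → Fin n) (i : Fin m) → f i ∈ image f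
∈-image⁺ f i = Vec.lookup⇒[]= (f i) (image f)
  (trans (Vec.lookup∘tabulate _ (f i)) (Equivalence.to T-≡ (fromWitness (i , refl))))

∈-image⁻ : (f : Fin m → Fin n) {v : Fin n} → v ∈ image f → ∃[ i ] f i ≡ v
∈-image⁻ f {v} v∈ = toWitness (Equivalence.from T-≡
  (trans (sym (Vec.lookup∘tabulate _ v)) (Vec.[]=⇒lookup v∈)))

-- Bounds on the chromatic number and the clique number.

χ≤ : (G : Graph n) → Colourable G k → χ G ≤ k
χ≤ G col = proj₂ (proj₂ (χ-exists G)) (_ , col)

-- Equal values of `f` at distinct indices would give a loop, so `f` is injective and its image is a
-- clique with at least `l` vertices.
clique≤ω : (G : Graph n) (f : Fin l → Fin n) → (∀ i j → i ≢ j → Graph._~_ G (f i) (f j)) → l ≤ ω G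
clique≤ω {n} {l} G f adj = ℕ.≤-trans (Fin.injective⇒≤ index-injective)
  (proj₂ (proj₂ (ω-exists G)) (S , isClique))
  where
  open Graph G

  S = image f

  f-injective : Injective _≡_ _≡_ f
  f-injective {i} {j} eq = decidable-stable (i Fin.≟ j) λ i≢j → ~-irr eq (adj i j i≢j)

  index : (i : Fin l) → ∃[ j ] embed S j ≡ f i
  index i = embed-surjective S (∈-image⁺ f i)

  index-injective : Injective _≡_ _≡_ (proj₁ ∘ index)
  index-injective {i} {j} eq = f-injective
    (trans (sym (proj₂ (index i))) (trans (cong (embed S) eq) (proj₂ (index j))))

  isClique : IsClique G S
  isClique u v u∈S v∈S u≢v with ∈-image⁻ f u∈S | ∈-image⁻ f v∈S
  ... | i , refl | j , refl = adj i j λ i≡j → u≢v (cong f i≡j)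

-- A homomorphism carries a maximum clique to a pairwise adjacent family of the same size.
ω-mono : (G : Graph m) (G′ : Graph n) (f : Fin m → Fin n) →
         (∀ {u v} → Graph._~_ G u v → Graph._~_ G′ (f u) (f v)) → ω G ≤ ω G′
ω-mono G G′ f hom with ((S , clique) , ∣S∣≡ω) , _ ← proj₂ (ω-exists G) =
  subst (_≤ ω G′) ∣S∣≡ω (clique≤ω G′ (f ∘ embed S) λ i j i≢j →
    hom (clique _ _ (embed-∈ S i) (embed-∈ S j) (i≢j ∘ embed-injective S)))

-- Pairwise relations and removal of an entry in lists.

module _ {A : Set} where

  AllPairs-lookup : {R : Rel A 0ℓ} → Symmetric R → ∀ {xs} → AllPairs R xs →
                    ∀ i j → i ≢ j → R (List.lookup xs i) (List.lookup xs j)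
  AllPairs-lookup R-sym (r ∷ rs) zero    zero    i≢j = contradiction refl i≢j
  AllPairs-lookup R-sym (r ∷ rs) zero    (suc j) i≢j = All.lookup r (L.∈-lookup j)
  AllPairs-lookup R-sym (r ∷ rs) (suc i) zero    i≢j = R-sym (All.lookup r (L.∈-lookup i))
  AllPairs-lookup R-sym (r ∷ rs) (suc i) (suc j) i≢j =
    AllPairs-lookup R-sym rs i j (i≢j ∘ cong suc)

  AllPairs-─ : {R : Rel A 0ℓ} {P : A → Set} {xs : List A} (p : Any P xs) → AllPairs R xs → AllPairs R (xs ─ p)
  AllPairs-─ (here _)  (r ∷ rs) = rs
  AllPairs-─ (there p) (r ∷ rs) = All.─⁺ p r ∷ AllPairs-─ p rs

  ∈-─ : {P : A → Set} {x : A} {xs : List A} (p : Any P xs) → x L.∈ xs → x ≡ Any.lookup p ⊎ x L.∈ (xs ─ p)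
  ∈-─ (here _)  (here eq)  = inj₁ eq
  ∈-─ (here _)  (there x∈) = inj₂ x∈
  ∈-─ (there p) (here eq)  = inj₂ (here eq)
  ∈-─ (there p) (there x∈) = Sum.map₂ there (∈-─ p x∈)

-- Greedy pairing and the bound 2χ ≤ n + ω.

module _ (G : Graph n) where
  open Graph G

  infix 4 _∈ₚ_

  _∈ₚ_ : Fin n → Fin n × Fin n → Set
  x ∈ₚ (u , v) = x ≡ u ⊎ x ≡ v

  NonAdjacent : Fin n × Fin n → Set
  NonAdjacent (u , v) = ¬ u ~ v

  -- By `size`, twice the number of classes, `pairs` and `rest` together, is
  -- `length xs + length rest`; the clique number bounds the last term.
  record CliqueAfterPairing (xs : List (Fin n)) : Set where
    field
      pairs       : List (Fin n × Fin n)
      rest        : List (Fin n)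
      nonAdjacent : All NonAdjacent pairs
      clique      : AllPairs _~_ rest
      covers      : ∀ {x} → x L.∈ xs → Any (x ∈ₚ_) pairs ⊎ x L.∈ rest
      size        : length pairs + length pairs + length rest ≡ length xs

  -- A new vertex adjacent to all of `rest` enlarges the clique; otherwise it is paired with a
  -- non-neighbour, which leaves `rest`.
  pairGreedily : ∀ xs → CliqueAfterPairing xs
  pairGreedily [] = record
    { pairs = [] ; rest = [] ; nonAdjacent = [] ; clique = [] ; covers = λ () ; size = refl }
  pairGreedily (x ∷ xs) with pairGreedily xs
  ... | record { pairs = ps ; rest = rs ; nonAdjacent = na ; clique = cl ; covers = cov ; size = sz }
    with any? (λ y → ¬? (x ~? y)) rs
  ... | no none = record
    { pairs = ps
    ; rest = x ∷ rs
    ; nonAdjacent = na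
    ; clique = All.map (λ {y} → decidable-stable (x ~? y)) (All.¬Any⇒All¬ rs none) ∷ cl
    ; covers = λ where
        (here eq)  → inj₂ (here eq)
        (there x∈) → Sum.map₂ there (cov x∈)
    ; size = trans (ℕ.+-suc (length ps + length ps) (length rs)) (cong suc sz)
    }
  ... | yes p = record
    { pairs = (x , Any.lookup p) ∷ ps
    ; rest = rs ─ p
    ; nonAdjacent = Any.lookup-result p ∷ na
    ; clique = AllPairs-─ p cl
    ; covers = λ where
        (here eq)  → inj₁ (here (inj₁ eq))
        -- A vertex of the old `rest` either is the removed one, now second in the new pair, or
        -- remains.
        (there x∈) → Sum.[ inj₁ ∘ there , (λ y∈ → Sum.map₁ (λ eq → here (inj₂ eq)) (∈-─ p y∈)) ]′ (cov x∈)
    ; size = cong suc (trans (shift (length ps) (length (rs ─ p)))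
        (trans (cong (_+_ (length ps + length ps)) (sym (length-removeAt′ rs (Any.index p)))) sz))
    }
    where
    shift : ∀ a b → a + suc a + b ≡ a + a + suc b
    shift = ℕ-Solver.solve-∀

  -- Each vertex is coloured by the position of its selected class. Two vertices of one class are
  -- either equal or its two non-adjacent members, so no edge is monochromatic.
  classes-colour : (cs : List (Fin n × Fin n)) → All NonAdjacent cs →
                   (∀ x → Any (x ∈ₚ_) cs) → Colourable G (length cs)
  classes-colour cs na class = Any.index ∘ class , λ u v u~v eq →
    let i = Any.index (class v) in
    notBoth (Any.lookup-index (class v)) (All.lookup na (L.∈-lookup i)) u~v
      (subst (λ i → u ∈ₚ List.lookup cs i) eq (Any.lookup-index (class u)))
    where
    notBoth : ∀ {u v p} → v ∈ₚ p → NonAdjacent p → u ~ v → ¬ (u ∈ₚ p)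
    notBoth (inj₁ refl) a≁b u~v (inj₁ refl) = ~-irr refl u~v
    notBoth (inj₁ refl) a≁b u~v (inj₂ refl) = a≁b (~-sym u~v)
    notBoth (inj₂ refl) a≁b u~v (inj₁ refl) = a≁b u~v
    notBoth (inj₂ refl) a≁b u~v (inj₂ refl) = ~-irr refl u~v

  χ+χ≤n+ω : χ G + χ G ≤ n + ω G
  χ+χ≤n+ω = begin
    χ G + χ G                             ≤⟨ ℕ.+-mono-≤ χ≤p+r χ≤p+r ⟩
    (p + r) + (p + r)                     ≡⟨ regroup p r ⟩
    (p + p + r) + r                       ≡⟨ cong (_+ r) (trans size (length-tabulate {n = n} _)) ⟩
    n + r                                 ≤⟨ ℕ.+-monoʳ-≤ n (clique≤ω G (List.lookup rest) (AllPairs-lookup ~-sym clique)) ⟩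
    n + ω G                               ∎
    where
    open ℕ.≤-Reasoning
    open CliqueAfterPairing (pairGreedily (allFin n))
    p = length pairs
    r = length rest

    regroup : ∀ a b → (a + b) + (a + b) ≡ (a + a + b) + b
    regroup = ℕ-Solver.solve-∀

    -- A leftover vertex counts as a degenerate pair, non-adjacent by irreflexivity, so that pairs
    -- and singletons form one list of classes.
    diagonal : Fin n → Fin n × Fin n
    diagonal v = v , v

    classes : List (Fin n × Fin n)
    classes = pairs ++ List.map diagonal rest

    class : ∀ x → Any (x ∈ₚ_) classes
    class x = Sum.[ Any.++⁺ˡ , Any.++⁺ʳ pairs ∘ Any.map⁺ ∘ Any.map inj₁ ]′ (covers (L.∈-allFin x))

    χ≤p+r : χ G ≤ p + r
    χ≤p+r = subst (χ G ≤_)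
      (trans (length-++ pairs) (cong (_+_ p) (length-map diagonal rest)))
      (χ≤ G (classes-colour classes
        (All.++⁺ nonAdjacent (All.map⁺ (All.universal (λ _ → ~-irr refl) rest))) class))

-- Counting colours and choosing a vertex of each colour.

module _ (c : Fin n → ℕ) where

  colours : List ℕ
  colours = deduplicate ℕ._≟_ (tabulate c)

  colour-∈ : ∀ {x} → ∃[ v ] c v ≡ x → x L.∈ colours
  colour-∈ (v , refl) = L.∈-deduplicate⁺ ℕ._≟_ (L.∈-tabulate⁺ v)

  colourIndex : ∀ {x} → ∃[ v ] c v ≡ x → Fin (#colours c)
  colourIndex used = Any.index (colour-∈ used)

  colourIndex-injective : ∀ {x y} (p : ∃[ v ] c v ≡ x) (q : ∃[ v ] c v ≡ y) →
                          colourIndex p ≡ colourIndex q → x ≡ y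
  colourIndex-injective p q eq = trans (Any.lookup-index (colour-∈ p))
    (trans (cong (List.lookup colours) eq) (sym (Any.lookup-index (colour-∈ q))))

  injective⇒n≤#colours : Injective _≡_ _≡_ c → n ≤ #colours c
  injective⇒n≤#colours inj = Fin.injective⇒≤ {f = λ v → colourIndex (v , refl)}
    λ {u} {v} eq → inj (colourIndex-injective (u , refl) (v , refl) eq)

  -- Positions in the list of colours of `c` recolour `G`. The domains of `c` and `d` may differ:
  -- here `c` will live on the transversal and `d` on all of `H`.
  χ≤#colours : (G : Graph m) {d : Fin m → ℕ} → Proper G d → (∀ u → ∃[ v ] c v ≡ d u) → χ G ≤ #colours c
  χ≤#colours G proper used = χ≤ G (colourIndex ∘ used , λ u v u~v eq →
    proper u v u~v (colourIndex-injective (used u) (used v) eq))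

  -- Since recompute ignores its irrelevant argument, the chosen vertex depends
  -- on the colour x only.
  representative : (x : ℕ) → .(∃[ v ] c v ≡ x) → ∃[ v ] c v ≡ x
  representative x = recompute (Fin.any? λ v → c v ℕ.≟ x)

  representative-cong : ∀ {x y} .{p : ∃[ v ] c v ≡ x} .{q : ∃[ v ] c v ≡ y} → x ≡ y →
                        proj₁ (representative x p) ≡ proj₁ (representative y q)
  representative-cong refl = refl

  normalise : Fin n → Fin n
  normalise v = proj₁ (representative (c v) (v , refl))

  c∘normalise : ∀ v → c (normalise v) ≡ c v
  c∘normalise v = proj₂ (representative (c v) (v , refl))

-- The transversal of the colour classes on an induced subgraph.

module _ (c : Fin n → ℕ) (H : InducedSubgraph n) where
  private
    e = embed (vertices H)
    r = e ∘ normalise (c ∘ e)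

  transversal : InducedSubgraph n
  transversal = ⟨ image r ⟩
    -- The representative of the first vertex of `H` shows that the image is nonempty.
    {{Fin.nonZeroIndex (proj₁ (embed-surjective (image r) (∈-image⁺ r (vertex H))))}}
    where
    vertex : (H : InducedSubgraph n) → Fin (order H)
    vertex H@(⟨ _ ⟩) = fromℕ< (ℕ.>-nonZero⁻¹ (order H))

  private
    t = embed (vertices transversal)

  transversal-⊆ : ∀ i → ∃[ j ] r j ≡ t i
  transversal-⊆ i = ∈-image⁻ r (embed-∈ (vertices transversal) i)

  -- Both vertices are representatives; `normalise` preserves colours, so they represent the same
  -- colour and hence coincide.
  transversal-injective : Injective _≡_ _≡_ (c ∘ t)
  transversal-injective {i} {i′} eq with transversal-⊆ i | transversal-⊆ i′
  ... | j , rj≡ti | j′ , rj′≡ti′ = embed-injective (vertices transversal)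
    (trans (sym rj≡ti) (trans (cong e (representative-cong (c ∘ e) cj≡cj′)) rj′≡ti′))
    where
    cj≡cj′ : c (e j) ≡ c (e j′)
    cj≡cj′ = trans (sym (c∘normalise (c ∘ e) j)) (trans (cong c rj≡ti)
      (trans eq (trans (cong c (sym rj′≡ti′)) (c∘normalise (c ∘ e) j′))))

  transversal-complete : ∀ j → ∃[ i ] c (t i) ≡ c (e j)
  transversal-complete j with i , ti≡rj ← embed-surjective (image r) (∈-image⁺ r j) =
    i , trans (cong c ti≡rj) (c∘normalise (c ∘ e) j)

  ω-transversal : (G : Graph n) → ω (G [ transversal ]) ≤ ω (G [ H ])
  -- The map is the inclusion of the transversal: `normalise` yields the position in `H` of the
  -- vertex `t i`.
  ω-transversal G = ω-mono (G [ transversal ]) (G [ H ]) (normalise (c ∘ e) ∘ proj₁ ∘ transversal-⊆)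
    λ {u} {v} → subst₂ (Graph._~_ G) (sym (proj₂ (transversal-⊆ u))) (sym (proj₂ (transversal-⊆ v)))

  -- This is χ(H) - ω(H) ≤ 2(a - x) with the subtracted terms moved across to stay in ℕ. One `a`
  -- bounds χ(H), as all colours of `H` occur on the transversal; the other bounds its order, as its
  -- colours are distinct.
  χ+2χ-transversal≤ : (G : Graph n) → Proper G c →
    let x = χ (G [ transversal ]); a = #coloursOn c transversal in
    χ (G [ H ]) + (x + x) ≤ (a + a) + ω (G [ H ])
  χ+2χ-transversal≤ G proper = begin
    χ (G [ H ]) + (x + x)                              ≤⟨ ℕ.+-mono-≤ χ≤a (χ+χ≤n+ω (G [ T ])) ⟩
    a + (order T + ω (G [ T ]))                        ≤⟨ ℕ.+-monoʳ-≤ a (ℕ.+-mono-≤ order≤a (ω-transversal G)) ⟩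
    a + (a + ω (G [ H ]))                              ≡⟨ ℕ.+-assoc a a _ ⟨
    (a + a) + ω (G [ H ])                              ∎
    where
    open ℕ.≤-Reasoning
    T = transversal
    x = χ (G [ T ])
    a = #coloursOn c T

    χ≤a : χ (G [ H ]) ≤ a
    χ≤a = χ≤#colours (c ∘ t) (G [ H ]) (λ u v → proper (e u) (e v)) transversal-complete

    order≤a : order T ≤ a
    order≤a = injective⇒n≤#colours (c ∘ t) transversal-injective

-- The bound for one colouring, and the passage to the rationals.

χ-ω≤2φ_c : .{{_ : NonZero n}} (G : Graph n) (c : ProperColouring G) (H : InducedSubgraph n) →
  + χ (G [ H ]) - + ω (G [ H ]) ℤ.≤ discrepancyOf G c ℤ.+ discrepancyOf G c
χ-ω≤2φ_c G (c , proper) H = begin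
  + h - + w                       ≡⟨ pad (+ h) (+ w) (+ x) ⟩
  (+ h ℤ.+ (+ x ℤ.+ + x)) ℤ.+ s   ≤⟨ ℤ.+-monoˡ-≤ s (ℤ.+≤+ (χ+2χ-transversal≤ c H G proper)) ⟩
  ((+ a ℤ.+ + a) ℤ.+ + w) ℤ.+ s   ≡⟨ cancel (+ a) (+ w) (+ x) ⟩
  (+ a - + x) ℤ.+ (+ a - + x)     ≤⟨ ℤ.+-mono-≤ excess≤ excess≤ ⟩
  discrepancyOf G (c , proper) ℤ.+ discrepancyOf G (c , proper) ∎
  where
  open ℤ.≤-Reasoning
  T = transversal c H
  h = χ (G [ H ])
  w = ω (G [ H ])
  x = χ (G [ T ])
  a = #coloursOn c T
  -- Adding `s` to both sides turns the inequality over ℕ back into one between differences.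
  s = ℤ.- (+ w ℤ.+ (+ x ℤ.+ + x))

  pad : ∀ h w x → h - w ≡ (h ℤ.+ (x ℤ.+ x)) ℤ.+ (ℤ.- (w ℤ.+ (x ℤ.+ x)))
  pad = ℤ-Solver.solve-∀

  cancel : ∀ a w x → ((a ℤ.+ a) ℤ.+ w) ℤ.+ (ℤ.- (w ℤ.+ (x ℤ.+ x))) ≡ (a - x) ℤ.+ (a - x)
  cancel = ℤ-Solver.solve-∀

  excess≤ : + a - + x ℤ.≤ discrepancyOf G (c , proper)
  excess≤ = proj₂ (proj₂ (maxInduced-exists ℤ.≤-totalOrder (excess G (c , proper)))) T

-- For unnormalised fractions the inequality is the hypothesis after cross-multiplication, with no
-- reduction to lowest terms in the way.
½*z≤w : ∀ {z w : ℤ} → z ℤ.≤ w ℤ.+ w → ½ * (z / 1) ℚ.≤ w / 1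
½*z≤w {z} {w} z≤w+w = ℚ.toℚᵘ-cancel-≤ (begin
  toℚᵘ (½ * (z / 1))            ≃⟨ ℚ.toℚᵘ-homo-* ½ (z / 1) ⟩
  toℚᵘ ½ ℚᵘ.* toℚᵘ (z / 1)      ≃⟨ ℚᵘ.*-congˡ {toℚᵘ ½} (ℚ.toℚᵘ-fromℚᵘ (ℚᵘ.mkℚᵘ z 0)) ⟩
  toℚᵘ ½ ℚᵘ.* ℚᵘ.mkℚᵘ z 0       ≤⟨ ℚᵘ.*≤* (subst₂ ℤ._≤_ (left z) (right w) z≤w+w) ⟩
  ℚᵘ.mkℚᵘ w 0                   ≃⟨ ℚ.toℚᵘ-fromℚᵘ (ℚᵘ.mkℚᵘ w 0) ⟨
  toℚᵘ (w / 1)                  ∎)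
  where
  open ℚᵘ.≤-Reasoning

  left : ∀ z → z ≡ (+ 1 ℤ.* z) ℤ.* + 1
  left = ℤ-Solver.solve-∀

  right : ∀ w → w ℤ.+ w ≡ w ℤ.* + 2
  right = ℤ-Solver.solve-∀

theorem4p1 : ∀ {n : ℕ} .{{_ : NonZero n}} (G : Graph n) →
    φ G / 1 ≥ maxInduced ℚ-totalOrder (λ H → ½ * ((+ χ (G [ H ]) - + ω (G [ H ])) / 1))
theorem4p1 G
  -- Both extrema are attained, so it suffices to compare an optimal colouring `c` with a maximising
  -- `H`.
  with (c , φ_c≡φ) , _ ← proj₂ (φ-exists G)
     | (H , max) , _ ← proj₂ (maxInduced-exists ℚ-totalOrder
         (λ H → ½ * ((+ χ (G [ H ]) - + ω (G [ H ])) / 1)))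
  = subst₂ ℚ._≤_ max (cong (_/ 1) φ_c≡φ) (½*z≤w {w = discrepancyOf G c} (χ-ω≤2φ_c G c H))
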